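{- The frustration numbers of the six signed Petersen graphs are $l_0(+P)=0$, $l_0(P_1)=1$, $l_0(P_{2,2})=2$, $l_0(P_{2,3})=2$, $l_0(P_{3,2})=3$, $l_0(P_{3,3})=3$. Every signed Petersen graph has frustration number equal to its frustration index.
   Context: The Petersen graph $P$ has vertices $v_{ij}$ indexed by the 2-element subsets $\{i,j\}$ of $\{1,\dots,5\}$, with $v_{ij}v_{kl}$ an edge iff $\{i,j\}\cap\{k,l\}=\emptyset$. A signed Petersen graph is $(P,\sigma)$ with $\sigma:E(P)\to\{+,-\}$. A signed graph is balanced if every cycle has positive sign product. The frustration index $l$ is the smallest number of edges whose deletion leaves a balanced signed graph; the frustration number $l_0$ is the smallest number of vertices whose deletion leaves a balanced signed graph. Edge distance is distance in the line graph; in $P$ two disjoint edges are at distance 2 if some edge joins an endpoint of one to an endpoint of the other, and at distance 3 otherwise. $+P$: all edges positive; $P_1$: exactly one negative edge; $P_{2,2}$ / $P_{2,3}$: exactly two negative edges at distance 2 / 3; $P_{3,2}$: exactly three negative edges forming alternate edges of a 6-cycle of $P$; $P_{3,3}$: exactly three negative edges pairwise at distance 3. -}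

module Defs where

open import Data.Nat using (ℕ; _≤_)
open import Data.Fin using (Fin; _<_)
open import Data.Fin.Properties using (<-cmp)
open import Data.Product using (Σ; Σ-syntax; ∃; _×_; _,_; proj₁; proj₂)
open import Data.Sum using (_⊎_)
open import Data.List using (List; []; _∷_; length)
open import Data.List.Relation.Unary.All using (All; []; _∷_)
open import Data.List.Relation.Unary.Unique.Propositional using (Unique)
open import Data.List.Membership.Propositional using (_∈_; _∉_)
open import Data.Empty using (⊥-elim)
open import Relation.Nullary using (¬_)
open import Relation.Binary.PropositionalEquality using (_≡_; _≢_; sym)
open import Relation.Binary.Definitions using (tri<; tri≈; tri>)
open import Function.Bundles using (_⇔_)

-- The Petersen graph P.
-- Vertices: 2-element subsets {a,b} of {1..5} (here Fin 5), stored with a < b.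

record Vertex : Set where
  constructor ⟨_,_⟩
  field
    a b : Fin 5
    .a<b : a < b
open Vertex public

Adj : Vertex → Vertex → Set
Adj u v = (a u ≢ a v) × (a u ≢ b v) × (b u ≢ a v) × (b u ≢ b v)

Adj-sym : ∀ {u v} → Adj u v → Adj v u
Adj-sym (p , q , r , s) = (λ e → p (sym e)) , (λ e → r (sym e)) , (λ e → q (sym e)) , (λ e → s (sym e))

-- An (unordered) edge {u,v} of P, stored in the normal form a u < a v
-- (adjacent vertices always have a u ≠ a v).
record Edge : Set where
  field
    src tgt : Vertex
    .adj : Adj src tgt
    .ord : a src < a tgt
open Edge public

edgeOf : (u v : Vertex) → Adj u v → Edge
edgeOf u v adj with <-cmp (a u) (a v)
... | tri< lt _ _ = record { src = u ; tgt = v ; adj = adj ; ord = lt }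
... | tri≈ _ eq _ = ⊥-elim (proj₁ adj eq)
... | tri> _ _ gt = record { src = v ; tgt = u ; adj = Adj-sym {u} {v} adj ; ord = gt }

data Sign : Set where
  plus minus : Sign

_·_ : Sign → Sign → Sign
plus  · s = s
minus · plus = minus
minus · minus = plus

Signature : Set
Signature = Edge → Sign

closingPairs : Vertex → List Vertex → List (Vertex × Vertex)
closingPairs first [] = []
closingPairs first (x ∷ []) = (x , first) ∷ []
closingPairs first (x ∷ y ∷ r) = (x , y) ∷ closingPairs first (y ∷ r)

cyclePairs : List Vertex → List (Vertex × Vertex)
cyclePairs [] = []
cyclePairs (x ∷ r) = closingPairs x (x ∷ r)

AdjPair : Vertex × Vertex → Set
AdjPair p = Adj (proj₁ p) (proj₂ p)

record Cycle : Set where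
  field
    verts : List Vertex
    long : 3 ≤ length verts
    distinct : Unique verts
    adjs : All AdjPair (cyclePairs verts)
open Cycle public

edgesAll : ∀ {ps} → All AdjPair ps → List Edge
edgesAll [] = []
edgesAll {(u , v) ∷ _} (adj ∷ rest) = edgeOf u v adj ∷ edgesAll rest

cycleEdges : Cycle → List Edge
cycleEdges c = edgesAll (adjs c)

signProd : Signature → List Edge → Sign
signProd σ [] = plus
signProd σ (e ∷ es) = σ e · signProd σ es

cycleSign : Signature → Cycle → Sign
cycleSign σ c = signProd σ (cycleEdges c)

Balanced : Signature → Set
Balanced σ = (c : Cycle) → cycleSign σ c ≡ plus

BalancedWithoutEdges : Signature → List Edge → Set
BalancedWithoutEdges σ S =
  (c : Cycle) → All (λ e → e ∉ S) (cycleEdges c) → cycleSign σ c ≡ plus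

BalancedWithoutVertices : Signature → List Vertex → Set
BalancedWithoutVertices σ W =
  (c : Cycle) → All (λ v → v ∉ W) (verts c) → cycleSign σ c ≡ plus

FrustrationIndex : Signature → ℕ → Set
FrustrationIndex σ n =
  (Σ[ S ∈ List Edge ] Unique S × length S ≡ n × BalancedWithoutEdges σ S)
  × ((S : List Edge) → Unique S → BalancedWithoutEdges σ S → n ≤ length S)

FrustrationNumber : Signature → ℕ → Set
FrustrationNumber σ n =
  (Σ[ W ∈ List Vertex ] Unique W × length W ≡ n × BalancedWithoutVertices σ W)
  × ((W : List Vertex) → Unique W → BalancedWithoutVertices σ W → n ≤ length W)

Endpoint : Vertex → Edge → Set
Endpoint v e = (v ≡ src e) ⊎ (v ≡ tgt e)

EdgesDisjoint : Edge → Edge → Set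
EdgesDisjoint e f = ¬ (Endpoint (src e) f) × ¬ (Endpoint (tgt e) f)

Joined : Edge → Edge → Set
Joined e f = Σ[ x ∈ Vertex ] Σ[ y ∈ Vertex ] Endpoint x e × Endpoint y f × Adj x y

EdgeDist2 : Edge → Edge → Set
EdgeDist2 e f = EdgesDisjoint e f × Joined e f

EdgeDist3 : Edge → Edge → Set
EdgeDist3 e f = EdgesDisjoint e f × ¬ Joined e f

NegativeSetIs : Signature → List Edge → Set
NegativeSetIs σ N = (e : Edge) → (σ e ≡ minus) ⇔ (e ∈ N)

IsPlusP : Signature → Set
IsPlusP σ = NegativeSetIs σ []

IsP1 : Signature → Set
IsP1 σ = Σ[ e ∈ Edge ] NegativeSetIs σ (e ∷ [])

IsP22 : Signature → Set
IsP22 σ = Σ[ e ∈ Edge ] Σ[ f ∈ Edge ] EdgeDist2 e f × NegativeSetIs σ (e ∷ f ∷ [])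

IsP23 : Signature → Set
IsP23 σ = Σ[ e ∈ Edge ] Σ[ f ∈ Edge ] EdgeDist3 e f × NegativeSetIs σ (e ∷ f ∷ [])

IsP32 : Signature → Set
IsP32 σ =
  Σ[ v0 ∈ Vertex ] Σ[ v1 ∈ Vertex ] Σ[ v2 ∈ Vertex ] Σ[ v3 ∈ Vertex ] Σ[ v4 ∈ Vertex ] Σ[ v5 ∈ Vertex ]
  Unique (v0 ∷ v1 ∷ v2 ∷ v3 ∷ v4 ∷ v5 ∷ []) ×
  Σ[ a01 ∈ Adj v0 v1 ] Σ[ a12 ∈ Adj v1 v2 ] Σ[ a23 ∈ Adj v2 v3 ]
  Σ[ a34 ∈ Adj v3 v4 ] Σ[ a45 ∈ Adj v4 v5 ] Σ[ a50 ∈ Adj v5 v0 ]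
  NegativeSetIs σ (edgeOf v0 v1 a01 ∷ edgeOf v2 v3 a23 ∷ edgeOf v4 v5 a45 ∷ [])

IsP33 : Signature → Set
IsP33 σ = Σ[ e ∈ Edge ] Σ[ f ∈ Edge ] Σ[ g ∈ Edge ]
  EdgeDist3 e f × EdgeDist3 e g × EdgeDist3 f g × NegativeSetIs σ (e ∷ f ∷ g ∷ [])

{-# OPTIONS --safe #-}
module Submission where

-- Deleting one endpoint of each edge of a balancing edge set balances the graph, so l₀ ≤ l. A
-- negative edge set N with distinct sources therefore has l₀ = l = |N| as soon as no set of
-- fewer than |N| vertices meets all the negative pentagons ("N is tight"), a finite condition
-- that is decidable. Tightness of the negative sets of the six types is checked by enumeration.
-- An arbitrary signature is switched so that a spanning tree is positive; it is then determined
-- by its signs on the six remaining edges, and each of the 64 resulting switching classes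
-- contains a signature with a tight negative set of at most three edges.

open import Defs
open import Data.Bool using (true; false; if_then_else_)
open import Data.Empty using (⊥; ⊥-elim; ⊥-elim-irr)
open import Data.Fin using (Fin; _<?_; _≟_)
open import Data.Fin.Patterns using (0F; 1F; 2F; 3F; 4F)
open import Data.Fin.Properties using (all?; <-cmp)
open import Data.List using (List; []; _∷_; _++_; concatMap; filter; length; map)
open import Data.List.Membership.Propositional using (_∈_; _∉_)
open import Data.List.Membership.Propositional.Properties using (∈-filter⁻; ∈-map⁺)
open import Data.List.Properties using (length-map)
open import Data.List.Relation.Unary.All as All using (All; []; _∷_)
open import Data.List.Relation.Unary.All.Properties using (++⁺)
open import Data.List.Relation.Unary.Any as Any using (Any; here; there)
open import Data.List.Relation.Unary.Any.Properties using (map⁻)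
open import Data.List.Relation.Unary.Unique.Propositional using (Unique; [])
import Data.List.Relation.Unary.Unique.Propositional.Properties as Unique
import Data.List.Relation.Unary.Unique.DecPropositional as DecUnique
import Data.List.Membership.DecPropositional as DecMembership
open import Data.Nat using (ℕ; zero; suc; _≤_; z≤n; s≤s)
import Data.Nat.Properties as ℕ
open import Data.Product using (Σ; Σ-syntax; _×_; _,_; proj₁; proj₂)
open import Data.Sum using (_⊎_; inj₁; inj₂)
open import Data.Unit using (⊤)
open import Data.Vec as Vec using (Vec; []; _∷_)
import Data.Vec.Properties as Vec
open import Function using (_∘_; id)
open import Function.Bundles using (Equivalence)
open import Relation.Binary.Definitions using (DecidableEquality; tri<; tri≈; tri>)
open import Relation.Binary.PropositionalEquality using (_≡_; _≢_; refl; sym; trans; cong; cong₂; subst; module ≡-Reasoning)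
open import Relation.Nullary using (¬_; Dec; yes; no; does; contradiction; invert)
open import Relation.Nullary.Decidable using (True; toWitness; from-yes; map′; ¬?; _×-dec_; _⊎-dec_; _→-dec_; _because_)
open import Relation.Unary using (Decidable)

-- Signs

·-assoc : ∀ x y z → (x · y) · z ≡ x · (y · z)
·-assoc plus  y     z     = refl
·-assoc minus plus  z     = refl
·-assoc minus minus plus  = refl
·-assoc minus minus minus = refl

·-comm : ∀ x y → x · y ≡ y · x
·-comm plus  plus  = refl
·-comm plus  minus = refl
·-comm minus plus  = refl
·-comm minus minus = refl

·-self : ∀ x → x · x ≡ plus
·-self plus  = refl
·-self minus = refl

_≟ˢ_ : DecidableEquality Sign
plus  ≟ˢ plus  = yes refl
plus  ≟ˢ minus = no λ ()
minus ≟ˢ plus  = no λ ()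
minus ≟ˢ minus = yes refl

plus≢minus : plus ≢ minus
plus≢minus ()

≢minus⇒≡plus : ∀ {x} → x ≢ minus → x ≡ plus
≢minus⇒≡plus {plus}  _ = refl
≢minus⇒≡plus {minus} p = contradiction refl p

∀SignVec? : ∀ n {P : Vec Sign n → Set} → Decidable P → Dec (∀ x → P x)
∀SignVec? zero    P? = map′ (λ p → λ { [] → p }) (λ f → f []) (P? [])
∀SignVec? (suc n) P? =
  map′ (λ (p , m) → λ { (plus ∷ x) → p x ; (minus ∷ x) → m x })
       (λ f → f ∘ (plus ∷_) , f ∘ (minus ∷_))
       (∀SignVec? n (P? ∘ (plus ∷_)) ×-dec ∀SignVec? n (P? ∘ (minus ∷_)))

-- The Petersen graph by enumeration

_≟ᵛ_ : DecidableEquality Vertex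
u ≟ᵛ v = map′ (λ { (refl , refl) → refl }) (λ { refl → refl , refl })
              (a u ≟ a v ×-dec b u ≟ b v)

_≟ᵉ_ : DecidableEquality Edge
e ≟ᵉ f = map′ (λ { (refl , refl) → refl }) (λ { refl → refl , refl })
              (src e ≟ᵛ src f ×-dec tgt e ≟ᵛ tgt f)

open DecMembership _≟ᵛ_ using () renaming (_∈?_ to _∈ᵛ?_)
open DecMembership _≟ᵉ_ using () renaming (_∈?_ to _∈ᵉ?_)
open DecUnique _≟ᵛ_ using (unique?)

Adj? : ∀ u v → Dec (Adj u v)
Adj? u v = ¬? (a u ≟ a v) ×-dec ¬? (a u ≟ b v) ×-dec ¬? (b u ≟ a v) ×-dec ¬? (b u ≟ b v)

vertex : (i j : Fin 5) {i<j : True (i <? j)} → Vertex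
vertex i j {i<j} = ⟨ i , j ⟩ (toWitness i<j)

edge : (u v : Vertex) {adj : True (Adj? u v)} {ord : True (a u <? a v)} → Edge
edge u v {adj} {ord} = record { src = u ; tgt = v ; adj = toWitness adj ; ord = toWitness ord }

v₁₂ v₁₃ v₁₄ v₁₅ v₂₃ v₂₄ v₂₅ v₃₄ v₃₅ v₄₅ : Vertex
v₁₂ = vertex 0F 1F
v₁₃ = vertex 0F 2F
v₁₄ = vertex 0F 3F
v₁₅ = vertex 0F 4F
v₂₃ = vertex 1F 2F
v₂₄ = vertex 1F 3F
v₂₅ = vertex 1F 4F
v₃₄ = vertex 2F 3F
v₃₅ = vertex 2F 4F
v₄₅ = vertex 3F 4F

vertices : List Vertex
vertices = v₁₂ ∷ v₁₃ ∷ v₁₄ ∷ v₁₅ ∷ v₂₃ ∷ v₂₄ ∷ v₂₅ ∷ v₃₄ ∷ v₃₅ ∷ v₄₅ ∷ []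

-- The breadth-first spanning tree rooted at v₁₂.
treeEdges : List Edge
treeEdges = edge v₁₂ v₃₄ ∷ edge v₁₂ v₃₅ ∷ edge v₁₂ v₄₅
          ∷ edge v₁₅ v₃₄ ∷ edge v₂₅ v₃₄ ∷ edge v₁₄ v₃₅
          ∷ edge v₂₄ v₃₅ ∷ edge v₁₃ v₄₅ ∷ edge v₂₃ v₄₅ ∷ []

coTreeEdges : Vec Edge 6
coTreeEdges = edge v₁₅ v₂₃ ∷ edge v₁₅ v₂₄ ∷ edge v₁₄ v₂₃
            ∷ edge v₁₄ v₂₅ ∷ edge v₁₃ v₂₄ ∷ edge v₁₃ v₂₅ ∷ []

edges : List Edge
edges = treeEdges ++ Vec.toList coTreeEdges

-- The order and adjacency fields are irrelevant, so a quantifier over them is decided by `B?` at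
-- one witness; any other is definitionally interchangeable with it.
∀irr? : {A : Set} {B : .(_ : A) → Set} → Dec A → ((x : A) → Dec (B x)) → Dec (.(x : A) → B x)
∀irr? (true  because [x])  B? = map′ (λ p _ → p) (λ f → f (invert [x])) (B? (invert [x]))
∀irr? (false because [¬x]) B? = yes λ x → ⊥-elim-irr (invert [¬x] x)

∈-vertices : ∀ v → v ∈ vertices
∈-vertices (⟨ i , j ⟩ i<j) = from-yes
  (all? λ i → all? λ j → ∀irr? (i <? j) λ i<j → ⟨ i , j ⟩ i<j ∈ᵛ? vertices) i j i<j

∀Vertex? : {P : Vertex → Set} → Decidable P → Dec (∀ v → P v)
∀Vertex? P? = map′ (λ ps v → All.lookup ps (∈-vertices v)) (λ f → All.universal f vertices)
                   (All.all? P? vertices)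

∈-edges : ∀ e → e ∈ edges
∈-edges record { src = u ; tgt = v ; adj = adj ; ord = ord } = from-yes
  (∀Vertex? λ u → ∀Vertex? λ v → ∀irr? (Adj? u v) λ adj → ∀irr? (a u <? a v) λ ord →
    record { src = u ; tgt = v ; adj = adj ; ord = ord } ∈ᵉ? edges) u v adj ord

∀Edge? : {P : Edge → Set} → Decidable P → Dec (∀ e → P e)
∀Edge? P? = map′ (λ ps e → All.lookup ps (∈-edges e)) (λ f → All.universal f edges)
                 (All.all? P? edges)

edgeOf-irrelevant : ∀ {u v} (p q : Adj u v) → edgeOf u v p ≡ edgeOf u v q
edgeOf-irrelevant {u} {v} p q with <-cmp (a u) (a v)
... | tri< _ _  _ = refl
... | tri≈ _ eq _ = ⊥-elim (proj₁ p eq)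
... | tri> _ _  _ = refl

-- All adjacency proofs yield the same edge, so `P` is tested at a single one.
∀edgeOf? : ∀ u v {P : Edge → Set} → Decidable P → Dec ((p : Adj u v) → P (edgeOf u v p))
∀edgeOf? u v {P} P? with Adj? u v
... | false because [¬p] = yes λ p → contradiction p (invert [¬p])
... | true  because [p]  = map′ (λ x q → subst P (edgeOf-irrelevant _ q) x) (λ f → f _)
                                (P? (edgeOf u v (invert [p])))

-- Switching

switch : (Vertex → Sign) → Signature → Signature
switch s σ e = s (src e) · (σ e · s (tgt e))

-- The switched sign reads the same from either end, so the orientation chosen by `edgeOf` has no
-- effect.
switch-edgeOf : ∀ s σ u v p → switch s σ (edgeOf u v p) ≡ s u · (σ (edgeOf u v p) · s v)
switch-edgeOf s σ u v p with <-cmp (a u) (a v)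
... | tri< _ _  _ = refl
... | tri≈ _ eq _ = ⊥-elim (proj₁ p eq)
... | tri> _ _  _ = reverse (s v) _ (s u)
  where
  reverse : ∀ x y z → x · (y · z) ≡ z · (y · x)
  reverse x y z = trans (·-comm x (y · z)) (trans (cong (_· x) (·-comm y z)) (·-assoc z y x))

-- Each interior vertex contributes its switching sign twice, which cancels; only the two ends
-- survive. Keeping `first` fixed lets the walk shrink from the front.
switch-walk : ∀ s σ first x r (ps : All AdjPair (closingPairs first (x ∷ r))) →
  signProd (switch s σ) (edgesAll ps) ≡ s x · (signProd σ (edgesAll ps) · s first)
switch-walk s σ first x [] (p ∷ []) = begin
  switch s σ e · plus                ≡⟨ ·-comm _ plus ⟩
  switch s σ e                       ≡⟨ switch-edgeOf s σ x first p ⟩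
  s x · (σ e · s first)              ≡⟨ cong (λ t → s x · (t · s first)) (·-comm plus (σ e)) ⟩
  s x · ((σ e · plus) · s first)     ∎
  where open ≡-Reasoning
        e = edgeOf x first p
switch-walk s σ first x (y ∷ r) (p ∷ ps) = begin
  switch s σ e · signProd (switch s σ) (edgesAll ps)
    ≡⟨ cong₂ _·_ (switch-edgeOf s σ x y p) (switch-walk s σ first y r ps) ⟩
  (s x · (σ e · s y)) · (s y · (π · s first))
    ≡⟨ telescope (s x) (σ e) (s y) (π · s first) ⟩
  s x · (σ e · (π · s first))
    ≡⟨ cong (s x ·_) (·-assoc (σ e) π (s first)) ⟨
  s x · ((σ e · π) · s first) ∎
  where
  open ≡-Reasoning
  e = edgeOf x y p
  π = signProd σ (edgesAll ps)
  telescope : ∀ w x y z → (w · (x · y)) · (y · z) ≡ w · (x · z)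
  telescope w x y z = begin
    (w · (x · y)) · (y · z) ≡⟨ ·-assoc w (x · y) (y · z) ⟩
    w · ((x · y) · (y · z)) ≡⟨ cong (w ·_) (·-assoc x y (y · z)) ⟩
    w · (x · (y · (y · z))) ≡⟨ cong (λ t → w · (x · t)) (·-assoc y y z) ⟨
    w · (x · ((y · y) · z)) ≡⟨ cong (λ t → w · (x · (t · z))) (·-self y) ⟩
    w · (x · z)             ∎

-- By Zaslavsky's criterion, the same as switching equivalence.
_≈_ : Signature → Signature → Set
σ ≈ τ = ∀ c → cycleSign σ c ≡ cycleSign τ c

signProd-cong : ∀ {σ τ} → (∀ e → σ e ≡ τ e) → ∀ es → signProd σ es ≡ signProd τ es
signProd-cong eq []       = refl
signProd-cong eq (e ∷ es) = cong₂ _·_ (eq e) (signProd-cong eq es)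

≗⇒≈ : ∀ {σ τ} → (∀ e → σ e ≡ τ e) → σ ≈ τ
≗⇒≈ eq c = signProd-cong eq (cycleEdges c)

-- A cycle is a closed walk, so the two surviving end signs are equal and cancel.
switch-≈ : ∀ s σ → switch s σ ≈ σ
switch-≈ s σ record { verts = x ∷ r ; adjs = ps } = begin
  signProd (switch s σ) (edgesAll ps) ≡⟨ switch-walk s σ x x r ps ⟩
  s x · (π · s x)                     ≡⟨ cong (s x ·_) (·-comm π (s x)) ⟩
  s x · (s x · π)                     ≡⟨ ·-assoc (s x) (s x) π ⟨
  (s x · s x) · π                     ≡⟨ cong (_· π) (·-self (s x)) ⟩
  π                                   ∎
  where open ≡-Reasoning
        π = signProd σ (edgesAll ps)

-- The sign of the tree path from v₁₂, so that switching by it makes every tree edge positive.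
potential : Signature → Vertex → Sign
potential σ (⟨ 2F , 3F ⟩ _) = σ (edge v₁₂ v₃₄)
potential σ (⟨ 2F , 4F ⟩ _) = σ (edge v₁₂ v₃₅)
potential σ (⟨ 3F , 4F ⟩ _) = σ (edge v₁₂ v₄₅)
potential σ (⟨ 0F , 4F ⟩ _) = σ (edge v₁₂ v₃₄) · σ (edge v₁₅ v₃₄)
potential σ (⟨ 1F , 4F ⟩ _) = σ (edge v₁₂ v₃₄) · σ (edge v₂₅ v₃₄)
potential σ (⟨ 0F , 3F ⟩ _) = σ (edge v₁₂ v₃₅) · σ (edge v₁₄ v₃₅)
potential σ (⟨ 1F , 3F ⟩ _) = σ (edge v₁₂ v₃₅) · σ (edge v₂₄ v₃₅)
potential σ (⟨ 0F , 2F ⟩ _) = σ (edge v₁₂ v₄₅) · σ (edge v₁₃ v₄₅)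
potential σ (⟨ 1F , 2F ⟩ _) = σ (edge v₁₂ v₄₅) · σ (edge v₂₃ v₄₅)
potential σ _               = plus

normalise : Signature → Signature
normalise σ = switch (potential σ) σ

-- With `plus` at the root, every tree edge receives the square of the sign of the tree path from
-- the root that ends with it.
normalise-tree : ∀ σ → All (λ e → normalise σ e ≡ plus) treeEdges
normalise-tree σ = ·-self (σ (edge v₁₂ v₃₄)) ∷ ·-self (σ (edge v₁₂ v₃₅)) ∷ ·-self (σ (edge v₁₂ v₄₅))
  ∷ leaf (σ (edge v₁₂ v₃₄)) (σ (edge v₁₅ v₃₄)) ∷ leaf (σ (edge v₁₂ v₃₄)) (σ (edge v₂₅ v₃₄))
  ∷ leaf (σ (edge v₁₂ v₃₅)) (σ (edge v₁₄ v₃₅)) ∷ leaf (σ (edge v₁₂ v₃₅)) (σ (edge v₂₄ v₃₅))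
  ∷ leaf (σ (edge v₁₂ v₄₅)) (σ (edge v₁₃ v₄₅)) ∷ leaf (σ (edge v₁₂ v₄₅)) (σ (edge v₂₃ v₄₅)) ∷ []
  where
  leaf : ∀ x y → (x · y) · (y · x) ≡ plus
  leaf x y = trans (cong ((x · y) ·_) (·-comm y x)) (·-self (x · y))

coTreeSigns : Signature → Vec Sign 6
coTreeSigns σ = Vec.map (normalise σ) coTreeEdges

-- After normalisation both signatures are `plus` on the tree and agree on the other six edges by
-- `eq`; normalising changes no cycle sign.
coTreeSigns-injective : ∀ σ τ → coTreeSigns σ ≡ coTreeSigns τ → σ ≈ τ
coTreeSigns-injective σ τ eq c = trans (sym (switch-≈ (potential σ) σ c))
  (trans (≗⇒≈ (λ e → All.lookup agree (∈-edges e)) c) (switch-≈ (potential τ) τ c))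
  where
  onCoTree : ∀ {n} (es : Vec Edge n) → Vec.map (normalise σ) es ≡ Vec.map (normalise τ) es →
             All (λ e → normalise σ e ≡ normalise τ e) (Vec.toList es)
  onCoTree []       _  = []
  onCoTree (e ∷ es) eq = Vec.∷-injectiveˡ eq ∷ onCoTree es (Vec.∷-injectiveʳ eq)
  agree : All (λ e → normalise σ e ≡ normalise τ e) edges
  agree = ++⁺ (All.zipWith (λ (p , q) → trans p (sym q)) (normalise-tree σ , normalise-tree τ))
              (onCoTree coTreeEdges eq)

FrustrationNumber-resp-≈ : ∀ {σ τ n} → σ ≈ τ → FrustrationNumber τ n → FrustrationNumber σ n
FrustrationNumber-resp-≈ eq ((W , W! , |W| , bal) , lower) =
  (W , W! , |W| , λ c out → trans (eq c) (bal c out)) ,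
  λ W W! bal → lower W W! λ c out → trans (sym (eq c)) (bal c out)

FrustrationIndex-resp-≈ : ∀ {σ τ n} → σ ≈ τ → FrustrationIndex τ n → FrustrationIndex σ n
FrustrationIndex-resp-≈ eq ((S , S! , |S| , bal) , lower) =
  (S , S! , |S| , λ c out → trans (eq c) (bal c out)) ,
  λ S S! bal → lower S S! λ c out → trans (sym (eq c)) (bal c out)

-- Deletion bounds

cycle-sources : ∀ {Q : Vertex → Set} (c : Cycle) → All Q (verts c) → All (Q ∘ src) (cycleEdges c)
cycle-sources {Q} record { verts = first ∷ r ; adjs = ps } (q₀ ∷ qs) = go first r ps (q₀ ∷ qs)
  where
  src-edgeOf : ∀ u v p → Q u → Q v → Q (src (edgeOf u v p))
  src-edgeOf u v p qu qv with <-cmp (a u) (a v)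
  ... | tri< _ _  _ = qu
  ... | tri≈ _ eq _ = ⊥-elim (proj₁ p eq)
  ... | tri> _ _  _ = qv
  go : ∀ x r (ps : All AdjPair (closingPairs first (x ∷ r))) → All Q (x ∷ r) → All (Q ∘ src) (edgesAll ps)
  -- The closing edge returns to `first`, which may be its source; hence `q₀` is kept throughout.
  go x []      (p ∷ []) (q ∷ [])      = src-edgeOf x first p q q₀ ∷ []
  go x (y ∷ r) (p ∷ ps) (q ∷ q′ ∷ qs) = src-edgeOf x y p q q′ ∷ go y r ps (q′ ∷ qs)

-- A cycle through an edge of `S` passes through the source of that edge. This is the source of l₀ ≤
-- l.
deleteSources : ∀ {σ} S → BalancedWithoutEdges σ S → BalancedWithoutVertices σ (map src S)
deleteSources S bal c out = bal c (All.map (_∘ ∈-map⁺ src) (cycle-sources c out))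

-- k ≤τ cs: no set of fewer than k vertices meets every cycle in cs.
_≤τ_ : ℕ → List Cycle → Set
zero  ≤τ cs       = ⊤
suc k ≤τ []       = ⊥
suc k ≤τ (c ∷ cs) = ∀ v → k ≤τ filter (λ c → ¬? (v ∈ᵛ? verts c)) (c ∷ cs)

_≤τ?_ : ∀ k cs → Dec (k ≤τ cs)
zero  ≤τ? cs       = yes _
suc k ≤τ? []       = no id
suc k ≤τ? (c ∷ cs) = ∀Vertex? λ v → k ≤τ? filter (λ c → ¬? (v ∈ᵛ? verts c)) (c ∷ cs)

-- Induction on `k`: the cycles that miss the first vertex `w` must all be met by the rest of `W`,
-- and `p w` bounds the size of that rest.
transversal-bound : ∀ k cs W → k ≤τ cs → (∀ {c} → c ∈ cs → ¬ All (_∉ W) (verts c)) → k ≤ length W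
transversal-bound zero    cs       W       _ _   = z≤n
transversal-bound (suc k) (c ∷ cs) []      _ hit = contradiction (All.universal (λ _ ()) _) (hit (here refl))
transversal-bound (suc k) (c ∷ cs) (w ∷ W) p hit = s≤s (transversal-bound k _ W (p w) hit′)
  where
  hit′ : ∀ {c′} → c′ ∈ filter (λ c → ¬? (w ∈ᵛ? verts c)) (c ∷ cs) → ¬ All (_∉ W) (verts c′)
  hit′ c′∈ out with ∈-filter⁻ (λ c → ¬? (w ∈ᵛ? verts c)) c′∈
  ... | c′∈cs , w∉c′ = hit c′∈cs (All.tabulate λ
    { u∈c′ (here refl) → w∉c′ u∈c′
    ; u∈c′ (there u∈W) → All.lookup out u∈c′ u∈W })

-- Pentagons and tight negative sets

cycle : (vs : List Vertex) {long : True (3 ℕ.≤? length vs)} {distinct : True (unique? vs)}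
        {adjs : True (All.all? (λ p → Adj? (proj₁ p) (proj₂ p)) (cyclePairs vs))} → Cycle
cycle vs {long} {distinct} {adjs} = record
  { verts = vs ; long = toWitness long ; distinct = toWitness distinct ; adjs = toWitness adjs }

-- All twelve 5-cycles of the Petersen graph, the first six being those through `v₁₂`.
pentagons : List Cycle
pentagons = cycle (v₁₂ ∷ v₃₄ ∷ v₁₅ ∷ v₂₃ ∷ v₄₅ ∷ [])
          ∷ cycle (v₁₂ ∷ v₃₅ ∷ v₁₄ ∷ v₂₃ ∷ v₄₅ ∷ [])
          ∷ cycle (v₁₂ ∷ v₃₄ ∷ v₁₅ ∷ v₂₄ ∷ v₃₅ ∷ [])
          ∷ cycle (v₁₂ ∷ v₄₅ ∷ v₁₃ ∷ v₂₄ ∷ v₃₅ ∷ [])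
          ∷ cycle (v₁₂ ∷ v₃₅ ∷ v₁₄ ∷ v₂₅ ∷ v₃₄ ∷ [])
          ∷ cycle (v₁₂ ∷ v₄₅ ∷ v₁₃ ∷ v₂₅ ∷ v₃₄ ∷ [])
          ∷ cycle (v₁₃ ∷ v₂₄ ∷ v₁₅ ∷ v₂₃ ∷ v₄₅ ∷ [])
          ∷ cycle (v₁₃ ∷ v₂₅ ∷ v₁₄ ∷ v₂₃ ∷ v₄₅ ∷ [])
          ∷ cycle (v₁₃ ∷ v₂₄ ∷ v₁₅ ∷ v₃₄ ∷ v₂₅ ∷ [])
          ∷ cycle (v₁₃ ∷ v₂₅ ∷ v₁₄ ∷ v₃₅ ∷ v₂₄ ∷ [])
          ∷ cycle (v₁₄ ∷ v₂₃ ∷ v₁₅ ∷ v₂₄ ∷ v₃₅ ∷ [])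
          ∷ cycle (v₁₄ ∷ v₂₃ ∷ v₁₅ ∷ v₃₄ ∷ v₂₅ ∷ []) ∷ []

signature : List Edge → Signature
signature N e = if does (e ∈ᵉ? N) then minus else plus

signature-∉ : ∀ N {e} → e ∉ N → signature N e ≡ plus
signature-∉ N {e} e∉N with e ∈ᵉ? N
... | yes e∈N = contradiction e∈N e∉N
... | no  _   = refl

NegativeSetIs⇒≈ : ∀ {σ} N → NegativeSetIs σ N → σ ≈ signature N
NegativeSetIs⇒≈ {σ} N neg = ≗⇒≈ agree
  where
  agree : ∀ e → σ e ≡ signature N e
  agree e with e ∈ᵉ? N
  ... | yes e∈N = Equivalence.from (neg e) e∈N
  ... | no  e∉N = ≢minus⇒≡plus (e∉N ∘ Equivalence.to (neg e))

delete-negatives : ∀ N → BalancedWithoutEdges (signature N) N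
delete-negatives N c out = allPlus out
  where
  allPlus : ∀ {es} → All (_∉ N) es → signProd (signature N) es ≡ plus
  allPlus []           = refl
  allPlus (e∉N ∷ es∉N) = cong₂ _·_ (signature-∉ N e∉N) (allPlus es∉N)

-- Pentagons suffice as obstructions: they generate the cycle space of P with at most two
-- vertices deleted.
negativePentagons : Signature → List Cycle
negativePentagons σ = filter (λ c → cycleSign σ c ≟ˢ minus) pentagons

-- A negative pentagon disjoint from `W` would survive the deletion and contradict balance, so `W`
-- meets them all.
vertexDeletion-bound : ∀ {σ k} → k ≤τ negativePentagons σ →
  ∀ W → BalancedWithoutVertices σ W → k ≤ length W
vertexDeletion-bound {σ} k≤τ W bal = transversal-bound _ (negativePentagons σ) W k≤τ λ {c} c∈ out →
  plus≢minus (trans (sym (bal c out))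
    (proj₂ (∈-filter⁻ (λ c → cycleSign σ c ≟ˢ minus) {xs = pentagons} c∈)))

Tight : List Edge → Set
Tight N = Unique (map src N) × length N ≤τ negativePentagons (signature N)

Tight? : Decidable Tight
Tight? N = unique? (map src N) ×-dec (length N ≤τ? negativePentagons (signature N))

Tight⇒FrustrationNumber : ∀ {N} → Tight N → FrustrationNumber (signature N) (length N)
Tight⇒FrustrationNumber {N} (N! , N≤τ) =
  (map src N , N! , length-map src N , deleteSources N (delete-negatives N)) ,
  λ W _ → vertexDeletion-bound N≤τ W

-- Distinct sources force distinct edges, so `N` itself attains the value. The lower bound passes
-- through vertices: the sources of a balancing `S` meet every negative pentagon.
Tight⇒FrustrationIndex : ∀ {N} → Tight N → FrustrationIndex (signature N) (length N)
Tight⇒FrustrationIndex {N} (N! , N≤τ) =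
  (N , Unique.map⁻ N! , refl , delete-negatives N) ,
  λ S _ bal → subst (length N ≤_) (length-map src S)
    (vertexDeletion-bound N≤τ (map src S) (deleteSources S bal))

-- The six types

EdgesDisjoint? : ∀ e f → Dec (EdgesDisjoint e f)
EdgesDisjoint? e f = ¬? (Endpoint? (src e)) ×-dec ¬? (Endpoint? (tgt e))
  where
  Endpoint? : ∀ v → Dec (Endpoint v f)
  Endpoint? v = (v ≟ᵛ src f) ⊎-dec (v ≟ᵛ tgt f)

Joined? : ∀ e f → Dec (Joined e f)
Joined? e f = map′ to from
  (Adj? (src e) (src f) ⊎-dec Adj? (src e) (tgt f) ⊎-dec Adj? (tgt e) (src f) ⊎-dec Adj? (tgt e) (tgt f))
  where
  Cases = Adj (src e) (src f) ⊎ Adj (src e) (tgt f) ⊎ Adj (tgt e) (src f) ⊎ Adj (tgt e) (tgt f)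
  to : Cases → Joined e f
  to (inj₁ p)               = _ , _ , inj₁ refl , inj₁ refl , p
  to (inj₂ (inj₁ p))        = _ , _ , inj₁ refl , inj₂ refl , p
  to (inj₂ (inj₂ (inj₁ p))) = _ , _ , inj₂ refl , inj₁ refl , p
  to (inj₂ (inj₂ (inj₂ p))) = _ , _ , inj₂ refl , inj₂ refl , p
  from : Joined e f → Cases
  from (_ , _ , inj₁ refl , inj₁ refl , p) = inj₁ p
  from (_ , _ , inj₁ refl , inj₂ refl , p) = inj₂ (inj₁ p)
  from (_ , _ , inj₂ refl , inj₁ refl , p) = inj₂ (inj₂ (inj₁ p))
  from (_ , _ , inj₂ refl , inj₂ refl , p) = inj₂ (inj₂ (inj₂ p))

EdgeDist3? : ∀ e f → Dec (EdgeDist3 e f)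
EdgeDist3? e f = EdgesDisjoint? e f ×-dec ¬? (Joined? e f)

edge-Tight : ∀ e → Tight (e ∷ [])
edge-Tight = from-yes (∀Edge? λ e → Tight? (e ∷ []))

-- Serves both `IsP22` and `IsP23`, whose two negative edges are disjoint.
disjointPair-Tight : ∀ e f → EdgesDisjoint e f → Tight (e ∷ f ∷ [])
disjointPair-Tight = from-yes (∀Edge? λ e → ∀Edge? λ f → EdgesDisjoint? e f →-dec Tight? (e ∷ f ∷ []))

-- The hypothesis on `e` and `f` precedes `g`, so the search discards other pairs before ranging
-- over the third edge.
dist3Triple-Tight : ∀ e f → EdgeDist3 e f → ∀ g → EdgeDist3 e g → EdgeDist3 f g → Tight (e ∷ f ∷ g ∷ [])
dist3Triple-Tight = from-yes (∀Edge? λ e → ∀Edge? λ f → EdgeDist3? e f →-dec ∀Edge? λ g →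
  EdgeDist3? e g →-dec EdgeDist3? f g →-dec Tight? (e ∷ f ∷ g ∷ []))

-- Each adjacency stands right after the vertex it constrains, which confines the search to walks
-- instead of all sextuples of vertices.
alternateHexagon-Tight : ∀ v₀ v₁ (a₀₁ : Adj v₀ v₁) v₂ → Adj v₁ v₂ → ∀ v₃ (a₂₃ : Adj v₂ v₃) v₄ → Adj v₃ v₄ →
  ∀ v₅ (a₄₅ : Adj v₄ v₅) → Adj v₅ v₀ → Unique (v₀ ∷ v₁ ∷ v₂ ∷ v₃ ∷ v₄ ∷ v₅ ∷ []) →
  Tight (edgeOf v₀ v₁ a₀₁ ∷ edgeOf v₂ v₃ a₂₃ ∷ edgeOf v₄ v₅ a₄₅ ∷ [])
alternateHexagon-Tight = from-yes (
  ∀Vertex? λ v₀ → ∀Vertex? λ v₁ → ∀edgeOf? v₀ v₁ λ e →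
  ∀Vertex? λ v₂ → Adj? v₁ v₂ →-dec ∀Vertex? λ v₃ → ∀edgeOf? v₂ v₃ λ f →
  ∀Vertex? λ v₄ → Adj? v₃ v₄ →-dec ∀Vertex? λ v₅ → ∀edgeOf? v₄ v₅ λ g →
  Adj? v₅ v₀ →-dec unique? (v₀ ∷ v₁ ∷ v₂ ∷ v₃ ∷ v₄ ∷ v₅ ∷ []) →-dec Tight? (e ∷ f ∷ g ∷ []))

-- Tight representatives of all switching classes

sublists : {A : Set} → ℕ → List A → List (List A)
sublists zero    _        = [] ∷ []
sublists (suc k) []       = []
sublists (suc k) (x ∷ xs) = map (x ∷_) (sublists k xs) ++ sublists (suc k) xs

-- The 576 sets of at most three edges; the search below finds a tight one in every class.
representatives : List (List Edge)
representatives = concatMap (λ k → sublists k edges) (0 ∷ 1 ∷ 2 ∷ 3 ∷ [])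

-- Tabulated and passed as an argument below, so that each coTreeSigns is evaluated once
-- and not once for each of the 64 vectors x.
coTreeTable : List (List Edge × Vec Sign 6)
coTreeTable = map (λ N → N , coTreeSigns (signature N)) representatives

-- Sign vectors are compared first, so tightness is tested only for sets in the class of `x`.
coversTightly? : (table : List (List Edge × Vec Sign 6)) →
  Dec (∀ x → Any (λ (N , y) → y ≡ x × Tight N) table)
coversTightly? table = ∀SignVec? 6 λ x → Any.any? (λ (N , y) → Vec.≡-dec _≟ˢ_ y x ×-dec Tight? N) table

everyClass-Tight : ∀ x → Any (λ N → coTreeSigns (signature N) ≡ x × Tight N) representatives
everyClass-Tight x = map⁻ (from-yes (coversTightly? coTreeTable) x)

switchesToTight : ∀ σ → Σ[ N ∈ List Edge ] σ ≈ signature N × Tight N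
switchesToTight σ = let N , eq , tight = Any.satisfied (everyClass-Tight (coTreeSigns σ)) in
  N , coTreeSigns-injective σ (signature N) (sym eq) , tight

NegativeSetIs⇒number : ∀ {σ} N → NegativeSetIs σ N → Tight N → FrustrationNumber σ (length N)
NegativeSetIs⇒number N neg tight = FrustrationNumber-resp-≈ (NegativeSetIs⇒≈ N neg) (Tight⇒FrustrationNumber tight)

-- Equality of the two invariants is expressed by one `n` serving both; here it is the size of the
-- tight representative.
index≡number : ∀ {σ} → Σ[ N ∈ List Edge ] σ ≈ signature N × Tight N →
  Σ ℕ λ n → FrustrationIndex σ n × FrustrationNumber σ n
index≡number (N , σ≈N , tight) = length N ,
  FrustrationIndex-resp-≈ σ≈N (Tight⇒FrustrationIndex tight) ,
  FrustrationNumber-resp-≈ σ≈N (Tight⇒FrustrationNumber tight)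

theorem7p7 : ((σ : Signature) → IsPlusP σ → FrustrationNumber σ 0)
    × ((σ : Signature) → IsP1 σ → FrustrationNumber σ 1)
    × ((σ : Signature) → IsP22 σ → FrustrationNumber σ 2)
    × ((σ : Signature) → IsP23 σ → FrustrationNumber σ 2)
    × ((σ : Signature) → IsP32 σ → FrustrationNumber σ 3)
    × ((σ : Signature) → IsP33 σ → FrustrationNumber σ 3)
    × ((σ : Signature) → Σ ℕ (λ n → FrustrationIndex σ n × FrustrationNumber σ n))
theorem7p7 =
  -- The empty set is tight outright: `zero ≤τ _` is the unit type, filled by `_`.
  (λ σ neg → NegativeSetIs⇒number [] neg ([] , _)) ,
  (λ σ (e , neg) → NegativeSetIs⇒number _ neg (edge-Tight e)) ,
  (λ σ (e , f , (disjoint , _) , neg) → NegativeSetIs⇒number _ neg (disjointPair-Tight e f disjoint)) ,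
  (λ σ (e , f , (disjoint , _) , neg) → NegativeSetIs⇒number _ neg (disjointPair-Tight e f disjoint)) ,
  (λ σ (v₀ , v₁ , v₂ , v₃ , v₄ , v₅ , distinct , a₀₁ , a₁₂ , a₂₃ , a₃₄ , a₄₅ , a₅₀ , neg) →
    NegativeSetIs⇒number _ neg
      (alternateHexagon-Tight v₀ v₁ a₀₁ v₂ a₁₂ v₃ a₂₃ v₄ a₃₄ v₅ a₄₅ a₅₀ distinct)) ,
  (λ σ (e , f , g , ef , eg , fg , neg) →
    NegativeSetIs⇒number _ neg (dist3Triple-Tight e f ef g eg fg)) ,
  λ σ → index≡number (switchesToTight σ)
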